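{- Let $n\in\mathbb N$ with $n\ge3$. Then $U_{2n}\equiv6\pmod{16}$ and $$U_{2n}\equiv48n-42\pmod{128}\ \text{ if } 2\mid n,\qquad U_{2n}\equiv-16n-42\pmod{128}\ \text{ if } 2\nmid n.$$
   Context: $\mathbb N$ is the set of positive integers; $[x]$ is the greatest integer not exceeding $x$. The sequence $\{U_n\}_{n\ge0}$ is defined by $U_0=1$ and $U_n=-2\sum_{k=1}^{[n/2]}\binom n{2k}U_{n-2k}$ for $n\ge1$. -}

module Defs where

open import Data.Nat.Base as ℕ using (ℕ; zero; suc; _≤_; _∸_; s≤s; ⌊_/2⌋)
open import Data.Nat.Properties
  using (_≤?_; ≤-refl; <⇒≱; m≤n⇒m<n∨m≡n; m∸n≤m)
open import Data.Nat.Combinatorics using (_C_)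
open import Data.Integer.Base using (ℤ; +_; -_; _+_; _-_; _*_; 0ℤ; 1ℤ)
open import Data.Integer.Divisibility.Signed using (_∣_)
open import Data.Bool.Base using (if_then_else_)
open import Data.Sum.Base using (inj₁; inj₂)
open import Relation.Nullary.Decidable using (does; dec-true; dec-false)
open import Relation.Binary.PropositionalEquality
  using (_≡_; refl; cong; cong₂)

infix 4 _≡_[mod_]

_≡_[mod_] : ℤ → ℤ → ℕ → Set
a ≡ b [mod m ] = + m ∣ a - b

-- sum₁ m f = f 1 + f 2 + ⋯ + f m; the index starts at 1, so f 0 is not used.
sum₁ : ℕ → (ℕ → ℤ) → ℤ
sum₁ zero    f = 0ℤ
sum₁ (suc m) f = sum₁ m f + f (suc m)

-- The right-hand side of the recurrence. Only k ≤ ⌊ n /2⌋ occurs, so the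
-- subtraction n ∸ 2k is never truncated.
step : ℕ → (ℕ → ℤ) → ℤ
step n V =
  - (+ 2) * sum₁ ⌊ n /2⌋ (λ k → + (n C (2 ℕ.* k)) * V (n ∸ 2 ℕ.* k))

-- Course-of-values recursion made structural: table n m is Uₘ for every
-- m ≤ n. Its values at m > n are never used.
table : ℕ → ℕ → ℤ
table zero    m = 1ℤ
table (suc n) m = if does (m ≤? n) then table n m else step (suc n) (table n)

U : ℕ → ℤ
U n = table n n

-- U-zero and U-suc characterise U: they are the defining equations of the
-- sequence, and nothing about table is needed beyond them.
U-zero : U 0 ≡ 1ℤ
U-zero = refl

table≡U : ∀ n {m} → m ≤ n → table n m ≡ U m
table≡U zero    ℕ.z≤n = refl
table≡U (suc n) {m} m≤1+n with m≤n⇒m<n∨m≡n m≤1+n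
... | inj₂ refl = refl
... | inj₁ (s≤s m≤n) rewrite dec-true (m ≤? n) m≤n = table≡U n m≤n

sum₁-cong : ∀ m {f g : ℕ → ℤ} → (∀ k → f (suc k) ≡ g (suc k)) →
            sum₁ m f ≡ sum₁ m g
sum₁-cong zero    eq = refl
sum₁-cong (suc m) eq = cong₂ _+_ (sum₁-cong m eq) (eq m)

U-suc : ∀ n → let N = suc n in
        U N ≡ - (+ 2) * sum₁ ⌊ N /2⌋ (λ k → + (N C (2 ℕ.* k)) * U (N ∸ 2 ℕ.* k))
U-suc n rewrite dec-false (suc n ≤? n) (<⇒≱ ≤-refl) =
  cong (- (+ 2) *_) (sum₁-cong ⌊ suc n /2⌋ λ k →
    cong (+ (suc n C (2 ℕ.* suc k)) *_)
      (table≡U n (m∸n≤m n (k ℕ.+ (suc k ℕ.+ 0)))))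

{-# OPTIONS --safe #-}
-- The recurrence is U₂ₙ = −2 Σₖ C(2n,2k) U₂ₖ with k < n, so U₂ₖ is only needed
-- modulo 64 to find U₂ₙ modulo 128. By strong induction U₂ₙ ≡ −16n − 42
-- (mod 128) for all n ≥ 3, which for even n is the same as 48n − 42: the sum of
-- C(2n,2k) (2a + 16k) over 0 ≤ k ≤ n vanishes modulo 64, so what remains is the
-- missing term k = n and the deviations of U₀ = 1, U₂ = −2, U₄ = 22 from the
-- linear formula, whose coefficients are 1, C(2n,2) and C(2n,4).
module Submission where

open import Defs
open import Data.Nat.Base as ℕ using (ℕ; zero; suc; _≥_; _<_; s≤s; z≤n; ⌊_/2⌋; _∸_)
open import Data.Nat.Divisibility as ℕ using ()
import Data.Nat.Properties as ℕ
open import Data.Nat.Combinatorics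
  using (_C_; nCk+nC[k+1]≡[n+1]C[k+1]; nCk≡nC[n∸k]; nC1≡n; k>n⇒nCk≡0)
open import Data.Nat.Induction using (<-rec)
open import Data.Integer.Base using (ℤ; +_; -_; _+_; _-_; _*_; 0ℤ; 1ℤ)
open import Data.Integer.Properties using (pos-+; pos-*; *-distribˡ-+)
open import Data.Integer.Divisibility.Signed
  using (_∣_; divides; ∣-trans; ∣m∣n⇒∣m+n; ∣n⇒∣m*n)
open import Data.Integer.Tactic.RingSolver using (solve-∀)
open import Data.Product.Base using (_×_; _,_; ∃; proj₁; proj₂)
open import Relation.Nullary.Negation.Core using (¬_)
open import Relation.Binary.PropositionalEquality
  using (_≡_; refl; sym; trans; cong; cong₂; subst; module ≡-Reasoning)
open ≡-Reasoning

-- Binomial coefficients and the recurrence for even indices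

-- Opaque, because _C_ and U compute and their unfolding swamps the type checker.
opaque
  binom : ℕ → ℕ → ℤ
  binom n k = + (n C k)

  u : ℕ → ℤ
  u n = U (2 ℕ.* n)

opaque
  unfolding binom

  binom-0 : ∀ n → binom n 0 ≡ 1ℤ
  binom-0 n = refl

  binom-1 : ∀ n → binom n 1 ≡ + n
  binom-1 n = cong +_ (nC1≡n n)

  pascal : ∀ n k → binom (suc n) (suc k) ≡ binom n k + binom n (suc k)
  pascal n k = trans (cong +_ (sym (nCk+nC[k+1]≡[n+1]C[k+1] n k)))
                     (pos-+ (n C k) (n C suc k))

  k>n⇒binom≡0 : ∀ {n k} → n < k → binom n k ≡ 0ℤ
  k>n⇒binom≡0 n<k = cong +_ (k>n⇒nCk≡0 n<k)

  binom-zero : ∀ k → binom 0 (suc k) ≡ 0ℤ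
  binom-zero k = refl

  binom-sym : ∀ {n k} → k ℕ.≤ n → binom n k ≡ binom n (n ∸ k)
  binom-sym k≤n = cong +_ (nCk≡nC[n∸k] k≤n)

  u-0 : u 0 ≡ 1ℤ
  u-0 = refl

  u-1 : u 1 ≡ - (+ 2)
  u-1 = refl

  u-2 : u 2 ≡ + 22
  u-2 = refl

  u≡U : ∀ n → u n ≡ U (2 ℕ.* n)
  u≡U n = refl

  -- An even index minus `2k` is even, so the even-indexed terms satisfy a recurrence of their own,
  -- and [2n/2] = n is its number of summands.
  u-suc : ∀ n → u (suc n) ≡
    - (+ 2) * sum₁ (suc n) (λ k → binom (2 ℕ.* suc n) (2 ℕ.* k) * u (suc n ∸ k))
  u-suc n = begin
    U (2 ℕ.* suc n)
      -- `2 * suc n` unfolds to the successor of `n + (suc n + 0)`.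
      ≡⟨ U-suc (n ℕ.+ (suc n ℕ.+ 0)) ⟩
    - (+ 2) * sum₁ ⌊ 2 ℕ.* suc n /2⌋ f
      ≡⟨ cong (λ h → - (+ 2) * sum₁ h f)
           (trans (cong (λ x → ⌊ suc n ℕ.+ x /2⌋) (ℕ.+-identityʳ (suc n)))
                  (sym (ℕ.n≡⌊n+n/2⌋ (suc n)))) ⟩
    - (+ 2) * sum₁ (suc n) f
      ≡⟨ cong (- (+ 2) *_) (sum₁-cong (suc n) λ k →
           cong (λ x → + (2 ℕ.* suc n C 2 ℕ.* suc k) * U x)
             (sym (ℕ.*-distribˡ-∸ 2 (suc n) (suc k)))) ⟩
    - (+ 2) * sum₁ (suc n)
      (λ k → + (2 ℕ.* suc n C 2 ℕ.* k) * U (2 ℕ.* (suc n ∸ k))) ∎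
    where
    f : ℕ → ℤ
    f k = + (2 ℕ.* suc n C 2 ℕ.* k) * U (2 ℕ.* suc n ∸ 2 ℕ.* k)

-- Divisibility and subtraction of finite sums

∣-sum₁ : ∀ {d} m {f} → (∀ k → k < m → d ∣ f (suc k)) → d ∣ sum₁ m f
∣-sum₁ zero    d∣f = divides 0ℤ refl
∣-sum₁ (suc m) d∣f =
  ∣m∣n⇒∣m+n (∣-sum₁ m λ k k<m → d∣f k (ℕ.m<n⇒m<1+n k<m)) (d∣f m ℕ.≤-refl)

sum₁-- : ∀ m f g → sum₁ m (λ k → f k - g k) ≡ sum₁ m f - sum₁ m g
sum₁-- zero    f g = refl
sum₁-- (suc m) f g rewrite sum₁-- m f g =
  regroup (sum₁ m f) (sum₁ m g) (f (suc m)) (g (suc m))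
  where
  regroup : ∀ a b c d → a - b + (c - d) ≡ a + c - (b + d)
  regroup = solve-∀

-- Binomial sums and Pascal's rule

binomialSum : ℕ → (ℕ → ℤ) → ℤ
binomialSum n f = f 0 + sum₁ n (λ j → binom n j * f j)

-- With E the shift operator this is 1 + E, and `binomialSum n f` is the value of (1 + E)^n f at 0.
-- There `f 0` stands alone because `sum₁` starts at 1.
twoTerm : (ℕ → ℤ) → ℕ → ℤ
twoTerm f j = f j + f (suc j)

-- The cut-off `m` is independent of the row `n`, which permits induction on `m`. The separate `f 1`
-- is the j = 0 term of the shifted sum, with coefficient `binom n 0` = 1.
sum₁-pascal : ∀ n m (f : ℕ → ℤ) →
  sum₁ (suc m) (λ j → binom (suc n) j * f j) ≡
  sum₁ (suc m) (λ j → binom n j * f j) + (f 1 + sum₁ m (λ j → binom n j * f (suc j)))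
sum₁-pascal n zero f rewrite pascal n 0 | binom-0 n = regroup (binom n 1) (f 1)
  where
  regroup : ∀ c x → 0ℤ + (1ℤ + c) * x ≡ 0ℤ + c * x + (x + 0ℤ)
  regroup = solve-∀
sum₁-pascal n (suc m) f rewrite sum₁-pascal n m f | pascal n (suc m) =
  regroup (sum₁ (suc m) (λ j → binom n j * f j)) (f 1)
    (sum₁ m (λ j → binom n j * f (suc j)))
    (binom n (suc m)) (binom n (suc (suc m))) (f (suc (suc m)))
  where
  regroup : ∀ s x t c d y →
    s + (x + t) + (c + d) * y ≡ s + d * y + (x + (t + c * y))
  regroup = solve-∀

sum₁-+ : ∀ m f g → sum₁ m (λ k → f k + g k) ≡ sum₁ m f + sum₁ m g
sum₁-+ zero    f g = refl
sum₁-+ (suc m) f g rewrite sum₁-+ m f g =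
  regroup (sum₁ m f) (sum₁ m g) (f (suc m)) (g (suc m))
  where
  regroup : ∀ a b c d → a + b + (c + d) ≡ a + c + (b + d)
  regroup = solve-∀

-- This is (1 + E)^(n+1) = (1 + E)^n (1 + E). Pascal's rule leaves one surplus term, whose
-- coefficient `binom n (suc n)` is zero.
binomialSum-suc : ∀ n f → binomialSum (suc n) f ≡ binomialSum n (twoTerm f)
binomialSum-suc n f = begin
  f 0 + sum₁ (suc n) (λ j → binom (suc n) j * f j)
    ≡⟨ cong (_+_ (f 0)) (sum₁-pascal n n f) ⟩
  f 0 + (sum₁ n F + binom n (suc n) * f (suc n) + (f 1 + sum₁ n G))
    ≡⟨ cong (λ c → f 0 + (sum₁ n F + c * f (suc n) + (f 1 + sum₁ n G)))
         (k>n⇒binom≡0 (ℕ.n<1+n n)) ⟩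
  f 0 + (sum₁ n F + 0ℤ * f (suc n) + (f 1 + sum₁ n G))
    ≡⟨ regroup (f 0) (f 1) (f (suc n)) (sum₁ n F) (sum₁ n G) ⟩
  f 0 + f 1 + (sum₁ n F + sum₁ n G)
    ≡⟨ cong (_+_ (f 0 + f 1)) (sum₁-+ n F G) ⟨
  f 0 + f 1 + sum₁ n (λ j → F j + G j)
    ≡⟨ cong (_+_ (f 0 + f 1)) (sum₁-cong n λ j →
         *-distribˡ-+ (binom n (suc j)) (f (suc j)) (f (suc (suc j)))) ⟨
  binomialSum n (twoTerm f) ∎
  where
  F G : ℕ → ℤ
  F j = binom n j * f j
  G j = binom n j * f (suc j)
  regroup : ∀ x y z s t → x + (s + 0ℤ * z + (y + t)) ≡ x + y + (s + t)
  regroup = solve-∀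

∣-binomialSum : ∀ {d} n {f} → (∀ j → d ∣ f j) → d ∣ binomialSum n f
∣-binomialSum n d∣f =
  ∣m∣n⇒∣m+n (d∣f 0) (∣-sum₁ n λ k _ → ∣n⇒∣m*n (binom n (suc k)) (d∣f (suc k)))

-- Selecting the even indices

-- The indicator of the even numbers is integer-valued, so that selection is multiplication and a
-- shift turns e into 1 - e, within reach of the ring solver.
even# : ℕ → ℤ
even# zero          = 1ℤ
even# (suc zero)    = 0ℤ
even# (suc (suc j)) = even# j

even#-suc : ∀ j → even# (suc j) ≡ 1ℤ - even# j
even#-suc zero          = refl
even#-suc (suc zero)    = refl
even#-suc (suc (suc j)) = even#-suc j

even#-2* : ∀ k → even# (2 ℕ.* k) ≡ 1ℤ
even#-2* zero    = refl
even#-2* (suc k) rewrite ℕ.*-suc 2 k = even#-2* k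

even#-1+2* : ∀ k → even# (suc (2 ℕ.* k)) ≡ 0ℤ
even#-1+2* k rewrite even#-suc (2 ℕ.* k) | even#-2* k = refl

-- Passing from n to n + 1 adds the indices 2n + 1 and 2n + 2, of which only the second has weight
-- 1.
sum₁-even# : ∀ n (f : ℕ → ℤ) →
  sum₁ (2 ℕ.* n) (λ j → even# j * f j) ≡ sum₁ n (λ k → f (2 ℕ.* k))
sum₁-even# zero    f = refl
sum₁-even# (suc n) f =
  trans (cong (λ m → sum₁ m (λ j → even# j * f j)) (ℕ.*-suc 2 n))
    (trans (last-two (sum₁-even# n f) (even#-1+2* n) (even#-2* n))
      (cong (λ m → sum₁ n (λ k → f (2 ℕ.* k)) + f m) (sym (ℕ.*-suc 2 n))))
  where
  regroup : ∀ s x y → s + 0ℤ * x + 1ℤ * y ≡ s + y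
  regroup = solve-∀
  last-two : ∀ {s s′ d e x y} → s ≡ s′ → d ≡ 0ℤ → e ≡ 1ℤ → s + d * x + e * y ≡ s′ + y
  last-two {s} {x = x} {y} refl refl refl = regroup s x y

-- Binomial sums of linear functions

binomialSum-cong : ∀ n {f g} → (∀ j → f j ≡ g j) → binomialSum n f ≡ binomialSum n g
binomialSum-cong n f≗g =
  cong₂ _+_ (f≗g 0) (sum₁-cong n λ k → cong (binom n (suc k) *_) (f≗g (suc k)))

linear : ℤ → ℤ → ℕ → ℤ
linear a b j = a + b * + j

binomialSum-linear : ∀ n a b →
  binomialSum (suc n) (linear a b) ≡ binomialSum n (linear (+ 2 * a + b) (+ 2 * b))
binomialSum-linear n a b =
  trans (binomialSum-suc n (linear a b)) (binomialSum-cong n λ j → regroup a b (+ j))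
  where
  regroup : ∀ a b x → a + b * x + (a + b * (1ℤ + x)) ≡ + 2 * a + b + + 2 * b * x
  regroup = solve-∀

-- Two applications of 1 + E remove the indicator: with e the indicator at j they give e (f(j) +
-- f(j+2)) + 2 (1 - e) f(j+1), and f(j) + f(j+2) = 2 f(j+1) for linear f, so 2 f(j+1) remains.
binomialSum-evenLinear : ∀ n a b →
  binomialSum (2 ℕ.+ n) (λ j → even# j * linear a b j) ≡
  binomialSum n (linear (+ 2 * a + + 2 * b) (+ 2 * b))
binomialSum-evenLinear n a b =
  trans (binomialSum-suc (suc n) f)
    (trans (binomialSum-suc n (twoTerm f)) (binomialSum-cong n twoTerm²))
  where
  f : ℕ → ℤ
  f j = even# j * linear a b j
  regroup : ∀ e a b x →
    e * (a + b * x) + (1ℤ - e) * (a + b * (1ℤ + x)) +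
      ((1ℤ - e) * (a + b * (1ℤ + x)) + e * (a + b * (+ 2 + x))) ≡
    + 2 * a + + 2 * b + + 2 * b * x
  regroup = solve-∀
  twoTerm² : ∀ j → twoTerm (twoTerm f) j ≡ linear (+ 2 * a + + 2 * b) (+ 2 * b) j
  twoTerm² j rewrite even#-suc j = regroup (even# j) a b (+ j)

binomialSum-linear² : ∀ n a b →
  binomialSum (2 ℕ.+ n) (linear a b) ≡ binomialSum n (linear (+ 4 * (a + b)) (+ 4 * b))
binomialSum-linear² n a b =
  trans (binomialSum-linear (suc n) a b)
    (trans (binomialSum-linear n (+ 2 * a + b) (+ 2 * b))
      (binomialSum-cong n λ j → regroup a b (+ j)))
  where
  regroup : ∀ a b x → + 2 * (+ 2 * a + b) + + 2 * b + + 2 * (+ 2 * b) * x ≡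
                      + 4 * (a + b) + + 4 * b * x
  regroup = solve-∀

-- Of six applications of 1 + E, the first two yield one factor 2 and the other four yield one each.
-- With the factor 2 in the coefficients `2a` and 8 this makes 2^6.
64∣binomialSum-evenLinear : ∀ n a →
  + 64 ∣ binomialSum (6 ℕ.+ n) (λ j → even# j * linear (+ 2 * a) (+ 8) j)
64∣binomialSum-evenLinear n a = subst (+ 64 ∣_) (sym eq)
  (∣-binomialSum n λ j → divides (a + + 12 + + 4 * + j) (regroup a (+ j)))
  where
  b = + 2 * (+ 2 * a) + + 2 * + 8
  eq : binomialSum (6 ℕ.+ n) (λ j → even# j * linear (+ 2 * a) (+ 8) j) ≡
       binomialSum n (linear (+ 4 * (+ 4 * (b + + 16) + + 64)) (+ 256))
  eq = trans (binomialSum-evenLinear (4 ℕ.+ n) (+ 2 * a) (+ 8))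
         (trans (binomialSum-linear² (2 ℕ.+ n) b (+ 16))
                (binomialSum-linear² n (+ 4 * (b + + 16)) (+ 64)))
  regroup : ∀ a x →
    + 4 * (+ 4 * (+ 2 * (+ 2 * a) + + 2 * + 8 + + 16) + + 64) + + 256 * x ≡
    (a + + 12 + + 4 * x) * + 64
  regroup = solve-∀

-- Slope 8 in j is slope 16 in k when j = 2k, and n ≥ 3 makes the row 2n at least 6. The leading
-- `2a` is the term k = 0.
64∣sum-C-even : ∀ m a → let n = 3 ℕ.+ m in
  + 64 ∣ + 2 * a + sum₁ n (λ k → binom (2 ℕ.* n) (2 ℕ.* k) * (+ 2 * a + + 16 * + k))
64∣sum-C-even m a = subst (+ 64 ∣_) eq (64∣binomialSum-evenLinear (2 ℕ.* m) a)
  where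
  n = 3 ℕ.+ m
  f : ℕ → ℤ
  f = linear (+ 2 * a) (+ 8)
  2*n : 6 ℕ.+ 2 ℕ.* m ≡ 2 ℕ.* n
  2*n = sym (ℕ.*-distribˡ-+ 2 3 m)
  swap : ∀ c e x → c * (e * x) ≡ e * (c * x)
  swap = solve-∀
  head : ∀ a → 1ℤ * (+ 2 * a + + 8 * 0ℤ) ≡ + 2 * a
  head = solve-∀
  double : ∀ a x → + 2 * a + + 8 * (+ 2 * x) ≡ + 2 * a + + 16 * x
  double = solve-∀
  eq : binomialSum (6 ℕ.+ 2 ℕ.* m) (λ j → even# j * f j) ≡
       + 2 * a + sum₁ n (λ k → binom (2 ℕ.* n) (2 ℕ.* k) * (+ 2 * a + + 16 * + k))
  eq = begin
    binomialSum (6 ℕ.+ 2 ℕ.* m) (λ j → even# j * f j)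
      ≡⟨ cong (λ N → binomialSum N (λ j → even# j * f j)) 2*n ⟩
    binomialSum (2 ℕ.* n) (λ j → even# j * f j)
      ≡⟨ cong₂ _+_ (head a)
           (sum₁-cong (2 ℕ.* n) λ k → swap (binom (2 ℕ.* n) (suc k)) (even# (suc k)) (f (suc k))) ⟩
    + 2 * a + sum₁ (2 ℕ.* n) (λ j → even# j * (binom (2 ℕ.* n) j * f j))
      ≡⟨ cong (_+_ (+ 2 * a)) (sum₁-even# n (λ j → binom (2 ℕ.* n) j * f j)) ⟩
    + 2 * a + sum₁ n (λ k → binom (2 ℕ.* n) (2 ℕ.* k) * f (2 ℕ.* k))
      ≡⟨ cong (_+_ (+ 2 * a)) (sum₁-cong n λ k → cong (binom (2 ℕ.* n) (2 ℕ.* suc k) *_)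
           (trans (cong (λ x → + 2 * a + + 8 * x) (pos-* 2 (suc k))) (double a (+ suc k)))) ⟩
    + 2 * a + sum₁ n (λ k → binom (2 ℕ.* n) (2 ℕ.* k) * (+ 2 * a + + 16 * + k)) ∎

-- The coefficients C(2n,2) and C(2n,4)

square-parity : ∀ n → ∃ λ t → + n * + n ≡ + n + + 2 * t
square-parity zero = 0ℤ , refl
square-parity (suc n) with t , eq ← square-parity n = t + + n , (begin
  (1ℤ + + n) * (1ℤ + + n)             ≡⟨ square (+ n) ⟩
  1ℤ + + 2 * + n + + n * + n          ≡⟨ cong (_+_ (1ℤ + + 2 * + n)) eq ⟩
  1ℤ + + 2 * + n + (+ n + + 2 * t)    ≡⟨ regroup (+ n) t ⟩
  1ℤ + + n + + 2 * (t + + n)          ∎)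
  where
  square : ∀ x → (1ℤ + x) * (1ℤ + x) ≡ 1ℤ + + 2 * x + x * x
  square = solve-∀
  regroup : ∀ x t → 1ℤ + + 2 * x + (x + + 2 * t) ≡ 1ℤ + x + + 2 * (t + x)
  regroup = solve-∀

pascal² : ∀ n k →
  binom (2 ℕ.+ n) (2 ℕ.+ k) ≡ binom n k + + 2 * binom n (suc k) + binom n (2 ℕ.+ k)
pascal² n k rewrite pascal (suc n) (suc k) | pascal n k | pascal n (suc k) =
  regroup (binom n k) (binom n (suc k)) (binom n (suc (suc k)))
  where
  regroup : ∀ a b c → a + b + (b + c) ≡ a + + 2 * b + c
  regroup = solve-∀

binom-2*suc : ∀ n k → binom (2 ℕ.* suc n) (2 ℕ.+ k) ≡
  binom (2 ℕ.* n) k + + 2 * binom (2 ℕ.* n) (suc k) + binom (2 ℕ.* n) (2 ℕ.+ k)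
binom-2*suc n k =
  trans (cong (λ m → binom m (2 ℕ.+ k)) (ℕ.*-suc 2 n)) (pascal² (2 ℕ.* n) k)

[2n]C2 : ∀ n → binom (2 ℕ.* n) 2 ≡ + 2 * (+ n * + n) - + n
[2n]C2 zero    = binom-zero 1
[2n]C2 (suc n) = trans (binom-2*suc n 0)
  (trans (sum-of (binom-0 (2 ℕ.* n)) (trans (binom-1 (2 ℕ.* n)) (pos-* 2 n)) ([2n]C2 n))
         (regroup (+ n)))
  where
  sum-of : ∀ {a b c a′ b′ c′} → a ≡ a′ → b ≡ b′ → c ≡ c′ →
           a + + 2 * b + c ≡ a′ + + 2 * b′ + c′
  sum-of refl refl refl = refl
  regroup : ∀ x → 1ℤ + + 2 * (+ 2 * x) + (+ 2 * (x * x) - x) ≡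
                  + 2 * ((1ℤ + x) * (1ℤ + x)) - (1ℤ + x)
  regroup = solve-∀

-- Twice this coefficient is met with the factor 96, and 96 · 4 = 3 · 128, so its value modulo 4
-- suffices. In the induction, C(2n,3) enters multiplied by 4 and is absorbed into `q`.
[2n]C4 : ∀ n → ∃ λ q → + 2 * binom (2 ℕ.* n) 4 ≡ + n * + n - + n + + 4 * q
[2n]C4 zero    = 0ℤ , cong (+ 2 *_) (binom-zero 3)
[2n]C4 (suc n) = let q , eq = [2n]C4 n in q + C₃ + + n * + n - + n , (begin
  + 2 * binom (2 ℕ.* suc n) 4
    ≡⟨ cong (+ 2 *_) (binom-2*suc n 2) ⟩
  + 2 * (C₂ + + 2 * C₃ + C₄)
    ≡⟨ expand C₂ C₃ C₄ ⟩
  + 2 * C₂ + + 4 * C₃ + + 2 * C₄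
    ≡⟨ cong₂ (λ c d → + 2 * c + + 4 * C₃ + d) ([2n]C2 n) eq ⟩
  + 2 * (+ 2 * (+ n * + n) - + n) + + 4 * C₃ + (+ n * + n - + n + + 4 * q)
    ≡⟨ regroup (+ n) C₃ q ⟩
  + suc n * + suc n - + suc n + + 4 * (q + C₃ + + n * + n - + n) ∎)
  where
  C₂ = binom (2 ℕ.* n) 2
  C₃ = binom (2 ℕ.* n) 3
  C₄ = binom (2 ℕ.* n) 4
  expand : ∀ b c d → + 2 * (b + + 2 * c + d) ≡ + 2 * b + + 4 * c + + 2 * d
  expand = solve-∀
  regroup : ∀ x c q →
    + 2 * (+ 2 * (x * x) - x) + + 4 * c + (x * x - x + + 4 * q) ≡
    (1ℤ + x) * (1ℤ + x) - (1ℤ + x) + + 4 * (q + c + x * x - x)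
  regroup = solve-∀

-- Strong induction modulo 128

residue : ℤ → ℤ
residue x = - (+ 16) * x - + 42

-- The shift by 3 lets strong induction start at n = 3, so that the hypothesis covers all i < m
-- without a lower bound.
Congruent : ℕ → Set
Congruent m = u (3 ℕ.+ m) ≡ residue (+ (3 ℕ.+ m)) [mod 128 ]

-- By this symmetry the coefficients at k = n - 2, n - 1, n become C(2n,4), C(2n,2), C(2n,0).
binom-2* : ∀ i j → binom (2 ℕ.* (i ℕ.+ j)) (2 ℕ.* j) ≡ binom (2 ℕ.* (i ℕ.+ j)) (2 ℕ.* i)
binom-2* i j = trans (binom-sym (ℕ.*-monoʳ-≤ 2 (ℕ.m≤n+m j i)))
  (cong (binom (2 ℕ.* (i ℕ.+ j)))
    (trans (sym (ℕ.*-distribˡ-∸ 2 (i ℕ.+ j) j)) (cong (2 ℕ.*_) (ℕ.m+n∸n≡m i j))))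

-- For k ≤ m the index n - k is at least 3 and the hypothesis applies; the last three summands
-- involve U₄, U₂, U₀. `S` is the sum over k ≤ m, and `T` is the same sum with each `u (n ∸ k)`
-- replaced by its residue, which equals 2a + 16k.
congruent-step : ∀ m → (∀ {i} → i < m → Congruent i) → Congruent m
congruent-step m ih = divides (- q₁ - q₂ - + 3 * q - x - + 5 * t - 1ℤ) (begin
  u n - residue x
    ≡⟨ cong (_- residue x) (u-suc (2 ℕ.+ m)) ⟩
  - (+ 2) * (S + f (1 ℕ.+ m) + f (2 ℕ.+ m) + f (3 ℕ.+ m)) - residue x
    ≡⟨ cong (λ s → - (+ 2) * s - residue x)
         (cong₂ _+_ (cong₂ _+_ (cong (_+_ S)
           (cong₂ _*_ (binom-2* 2 (1 ℕ.+ m)) (trans (cong u (ℕ.m+n∸n≡m 2 (1 ℕ.+ m))) u-2)))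
           (cong₂ _*_ (binom-2* 1 (2 ℕ.+ m)) (trans (cong u (ℕ.m+n∸n≡m 1 (2 ℕ.+ m))) u-1)))
           (cong₂ _*_ (trans (binom-2* 0 (3 ℕ.+ m)) (binom-0 (2 ℕ.* n)))
                      (trans (cong u (ℕ.n∸n≡0 n)) u-0))) ⟩
  - (+ 2) * (S + C₄ * + 22 + C₂ * - (+ 2) + 1ℤ * 1ℤ) - residue x
    ≡⟨ separate S T (+ m) C₂ C₄ ⟩
  combine (S - T)
    (+ 2 * a + (T + C₄ * (+ 2 * a + + 16 * + (1 ℕ.+ m))
                  + C₂ * (+ 2 * a + + 16 * + (2 ℕ.+ m))
                  + 1ℤ * (+ 2 * a + + 16 * x)))
    (+ 2 * C₄) C₂
    ≡⟨ combine-cong (_∣_.equality 64∣S-T)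
         (trans (cong (_+_ (+ 2 * a)) (sym T-last)) (_∣_.equality (64∣sum-C-even m a)))
         (proj₂ ([2n]C4 n)) ([2n]C2 n) ⟩
  combine (q₁ * + 64) (q₂ * + 64) (x * x - x + + 4 * q) (+ 2 * (x * x) - x)
    ≡⟨ collect q₁ q₂ q x (x * x) ⟩
  - (+ 128) * (q₁ + q₂ + + 3 * q + 1ℤ) - + 320 * (x * x) + + 192 * x
    -- Since n² = n + 2t, the rest -320 n² + 192 n becomes -128 n - 640 t, and 640 = 5 · 128.
    ≡⟨ cong (λ y → - (+ 128) * (q₁ + q₂ + + 3 * q + 1ℤ) - + 320 * y + + 192 * x)
         (proj₂ (square-parity n)) ⟩
  - (+ 128) * (q₁ + q₂ + + 3 * q + 1ℤ) - + 320 * (x + + 2 * t) + + 192 * x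
    ≡⟨ factor q₁ q₂ q x t ⟩
  (- q₁ - q₂ - + 3 * q - x - + 5 * t - 1ℤ) * + 128 ∎)
  where
  n = 3 ℕ.+ m
  x a C₂ C₄ S T q₁ q₂ q t : ℤ
  x = + n
  a = - (+ 8) * x - + 21
  f g : ℕ → ℤ
  f k = binom (2 ℕ.* n) (2 ℕ.* k) * u (n ∸ k)
  g k = binom (2 ℕ.* n) (2 ℕ.* k) * (+ 2 * a + + 16 * + k)
  C₂ = binom (2 ℕ.* n) 2
  C₄ = binom (2 ℕ.* n) 4
  S = sum₁ m f
  T = sum₁ m g

  -- Writing n as 3 + i + j replaces truncated subtraction by addition, so the residue at 3 + i can
  -- be matched with 2a + 16j by ring identities.
  64∣term : ∀ i j → Congruent i → 3 ℕ.+ i ℕ.+ j ≡ n → + 64 ∣ f j - g j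
  64∣term i j p i+j≡n = subst (+ 64 ∣_)
    (begin
      c * (u (3 ℕ.+ i) - residue (+ (3 ℕ.+ i)))
        ≡⟨ distrib c (u (3 ℕ.+ i)) (+ (3 ℕ.+ i)) (+ j) ⟩
      c * u (3 ℕ.+ i) - c * (+ 2 * (- (+ 8) * + (3 ℕ.+ i ℕ.+ j) - + 21) + + 16 * + j)
        ≡⟨ cong₂ (λ k y → c * u k - c * (+ 2 * (- (+ 8) * + y - + 21) + + 16 * + j))
             (trans (sym (ℕ.m+n∸n≡m (3 ℕ.+ i) j)) (cong (_∸ j) i+j≡n)) i+j≡n ⟩
      f j - g j ∎)
    (∣n⇒∣m*n c (∣-trans (divides (+ 2) refl) p))
    where
    c = binom (2 ℕ.* n) (2 ℕ.* j)
    distrib : ∀ c v y z → c * (v - (- (+ 16) * y - + 42)) ≡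
      c * v - c * (+ 2 * (- (+ 8) * (y + z) - + 21) + + 16 * z)
    distrib = solve-∀

  64∣S-T : + 64 ∣ S - T
  64∣S-T = subst (+ 64 ∣_) (sum₁-- m f g) (∣-sum₁ m λ k k<m →
    64∣term (m ∸ suc k) (suc k) (ih (ℕ.∸-monoʳ-< (s≤s z≤n) k<m))
      (cong (3 ℕ.+_) (ℕ.m∸n+n≡m k<m)))

  T-last : sum₁ n g ≡ T + C₄ * (+ 2 * a + + 16 * + (1 ℕ.+ m))
                        + C₂ * (+ 2 * a + + 16 * + (2 ℕ.+ m))
                        + 1ℤ * (+ 2 * a + + 16 * x)
  T-last = cong₂ _+_ (cong₂ _+_ (cong (_+_ T)
    (cong (_* (+ 2 * a + + 16 * + (1 ℕ.+ m))) (binom-2* 2 (1 ℕ.+ m))))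
    (cong (_* (+ 2 * a + + 16 * + (2 ℕ.+ m))) (binom-2* 1 (2 ℕ.+ m))))
    (cong (_* (+ 2 * a + + 16 * x)) (trans (binom-2* 0 (3 ℕ.+ m)) (binom-0 (2 ℕ.* n))))

  q₁ = _∣_.quotient 64∣S-T
  q₂ = _∣_.quotient (64∣sum-C-even m a)
  q = proj₁ ([2n]C4 n)
  t = proj₁ (square-parity n)

  -- At k = n - 2, n - 1, n the linear formula gives -74, -58, -42 instead of 22, -2, 1. The
  -- deviations 96, 56, 43 times -2 give -96 per 2 C(2n,4), -112 per C(2n,2), and -86. The k = 0
  -- term and the residue contribute -16n - 42, which completes the constant to -128.
  combine : ℤ → ℤ → ℤ → ℤ → ℤ
  combine A B D C = - (+ 2) * (A + B) - + 96 * D - + 112 * C - + 16 * x - + 128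

  combine-cong : ∀ {A B D C A′ B′ D′ C′} → A ≡ A′ → B ≡ B′ → D ≡ D′ → C ≡ C′ →
                 combine A B D C ≡ combine A′ B′ D′ C′
  combine-cong refl refl refl refl = refl

  separate : ∀ S T y C₂ C₄ →
    - (+ 2) * (S + C₄ * + 22 + C₂ * - (+ 2) + 1ℤ * 1ℤ) - (- (+ 16) * (+ 3 + y) - + 42) ≡
    - (+ 2) * ((S - T) + (+ 2 * (- (+ 8) * (+ 3 + y) - + 21) +
        (T + C₄ * (+ 2 * (- (+ 8) * (+ 3 + y) - + 21) + + 16 * (+ 1 + y))
           + C₂ * (+ 2 * (- (+ 8) * (+ 3 + y) - + 21) + + 16 * (+ 2 + y))
           + 1ℤ * (+ 2 * (- (+ 8) * (+ 3 + y) - + 21) + + 16 * (+ 3 + y)))))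
      - + 96 * (+ 2 * C₄) - + 112 * C₂ - + 16 * (+ 3 + y) - + 128
  separate = solve-∀

  collect : ∀ q₁ q₂ q x y →
    - (+ 2) * (q₁ * + 64 + q₂ * + 64) - + 96 * (y - x + + 4 * q)
      - + 112 * (+ 2 * y - x) - + 16 * x - + 128 ≡
    - (+ 128) * (q₁ + q₂ + + 3 * q + 1ℤ) - + 320 * y + + 192 * x
  collect = solve-∀

  factor : ∀ q₁ q₂ q x t →
    - (+ 128) * (q₁ + q₂ + + 3 * q + 1ℤ) - + 320 * (x + + 2 * t) + + 192 * x ≡
    (- q₁ - q₂ - + 3 * q - x - + 5 * t - 1ℤ) * + 128
  factor = solve-∀

congruent : ∀ m → Congruent m
congruent = <-rec Congruent congruent-step

U-congruent : ∀ n → n ≥ 3 → U (2 ℕ.* n) ≡ residue (+ n) [mod 128 ]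
U-congruent n@(suc (suc (suc m))) (s≤s (s≤s (s≤s z≤n))) =
  subst (λ v → v ≡ residue (+ n) [mod 128 ]) (u≡U n) (congruent m)

-- Passing to the stated residues

mod-trans : ∀ {d} v r s → v ≡ r [mod d ] → r ≡ s [mod d ] → v ≡ s [mod d ]
mod-trans {d} v r s v≡r r≡s = subst (+ d ∣_) (telescope v r s) (∣m∣n⇒∣m+n v≡r r≡s)
  where
  telescope : ∀ v r s → v - r + (r - s) ≡ v - s
  telescope = solve-∀

corollary4p1 : (n : ℕ) → n ≥ 3 →
    (U (2 ℕ.* n) ≡ + 6 [mod 16 ])
    × (2 ℕ.∣ n → U (2 ℕ.* n) ≡ + 48 * + n - + 42 [mod 128 ])
    × (¬ (2 ℕ.∣ n) → U (2 ℕ.* n) ≡ - (+ 16) * + n - + 42 [mod 128 ])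
corollary4p1 n n≥3 =
    mod-trans (U (2 ℕ.* n)) (residue (+ n)) (+ 6)
      (∣-trans (divides (+ 8) refl) (U-congruent n n≥3))
      -- Here -42 - 6 = -3 · 16.
      (divides (- (+ n) - + 3) (mod-16 (+ n)))
  , (λ { (ℕ.divides k refl) →
      mod-trans (U (2 ℕ.* n)) (residue (+ n)) (+ 48 * + n - + 42) (U-congruent n n≥3)
        -- The two formulas differ by 64n, which is 128k for n = 2k.
        (divides (- (+ k)) (trans (cong (λ x → residue x - (+ 48 * x - + 42)) (pos-* k 2))
                                  (mod-128 (+ k)))) })
  , λ _ → U-congruent n n≥3
  where
  mod-16 : ∀ x → - (+ 16) * x - + 42 - + 6 ≡ (- x - + 3) * + 16
  mod-16 = solve-∀
  mod-128 : ∀ k → - (+ 16) * (k * + 2) - + 42 - (+ 48 * (k * + 2) - + 42) ≡ - k * + 128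
  mod-128 = solve-∀
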